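{- There exist a prime power $q$, positive integers $n$ and $t$ with $t\mid n$ and $1<t<n$, and an R-$q^t$-partially scattered polynomial $f\in\mathcal{L}_{n,q}$ such that $(\mathbb{S}_f,+,\cdot)$ is not a field.
   Context: $\mathcal{L}_{n,q}$ is the set of $q$-polynomials $\sum_{i=0}^{n-1}a_ix^{q^i}$ with $a_i\in\mathbb{F}_{q^n}$, identified with the $\mathbb{F}_q$-linear endomorphisms of $\mathbb{F}_{q^n}$. The polynomial $f$ is R-$q^t$-partially scattered if for all $y,z\in\mathbb{F}_{q^n}^*$, $\frac{f(y)}{y}=\frac{f(z)}{z}$ and $\frac{y}{z}\in\mathbb{F}_{q^t}$ imply $\frac{y}{z}\in\mathbb{F}_q$. The graph of $f$ is $\mathcal{G}_f=\{(y,f(y)) : y\in\mathbb{F}_{q^n}\}$, and $\mathbb{S}_f=\{A\in\mathbb{F}_{q^n}^{2\times2} : A\mathcal{G}_f\subseteq\mathcal{G}_f\}$ with $A\mathcal{G}_f=\left\{A\begin{pmatrix}y\\ f(y)\end{pmatrix} : y\in\mathbb{F}_{q^n}\right\}$, equipped with the usual matrix sum and product. -}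

module Defs where

open import Algebra.Bundles using (CommutativeRing)
open import Algebra.Core using (Op₁; Op₂)
open import Algebra.Structures using (IsCommutativeRing)
import Algebra.Properties.AbelianGroup as AbelianGroupProperties
import Algebra.Properties.CommutativeSemiring.Binomial as Binomial
import Algebra.Properties.Semiring.Exp as Exp
import Algebra.Properties.Semiring.Mult as Mult
import Algebra.Properties.Semiring.Sum as Sum
open import Data.Empty using (⊥-elim)
open import Data.Fin.Base as Fin using (Fin; zero; suc; toℕ; fromℕ; inject₁)
import Data.Fin.Properties as Fin
open import Data.Fin.Permutation using (Permutation′; permutation)
open import Data.Nat.Base as ℕ using (ℕ; zero; suc; _<_; s≤s)
open import Data.Nat.Combinatorics using (_C_; nCn≡1; nC1≡n; nCk+nC[k+1]≡[n+1]C[k+1])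
open import Data.Nat.Divisibility using (_∣_; divides; >⇒∤)
open import Data.Nat.Primality using (Prime; euclidsLemma; prime⇒nonTrivial)
import Data.Nat.Properties as ℕ
open import Data.Product.Base using (Σ; ∃-syntax; Σ-syntax; _×_; _,_; proj₁; proj₂)
open import Data.Sum.Base using (inj₁; inj₂)
open import Data.Vec.Functional using (Vector)
open import Function.Base using (_∘_)
open import Function.Bundles using (Inverse)
open import Level using (0ℓ; _⊔_)
open import Relation.Binary.Bundles using (Setoid)
open import Relation.Binary.Core using (Rel)
open import Relation.Binary.PropositionalEquality as ≡ using (_≡_)
import Relation.Binary.Construct.On as On
import Relation.Binary.Reasoning.Setoid as SetoidReasoning
open import Relation.Nullary using (¬_; Dec; yes; no)
open import Relation.Nullary.Decidable using (map′)
open import Relation.Unary using (Pred; _∈_; _⊆_)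

IsPrimePower : ℕ → Set
IsPrimePower q = ∃[ p ] ∃[ k ] Prime p × 0 < k × q ≡ p ℕ.^ k

HasOrder : Setoid 0ℓ 0ℓ → ℕ → Set
HasOrder S m = Inverse S (≡.setoid (Fin m))

subsetSetoid : (S : Setoid 0ℓ 0ℓ) → Pred (Setoid.Carrier S) 0ℓ → Setoid 0ℓ 0ℓ
subsetSetoid S P = On.setoid {B = Σ (Setoid.Carrier S) P} S proj₁

record IsField {a ℓ} {A : Set a} (_≈_ : Rel A ℓ) (_+_ _*_ : Op₂ A)
               (-_ : Op₁ A) (0# 1# : A) : Set (a ⊔ ℓ) where
  field
    isCommutativeRing : IsCommutativeRing _≈_ _+_ _*_ -_ 0# 1#
    0≉1               : ¬ (0# ≈ 1#)
    inv               : ∀ x → ¬ (x ≈ 0#) → A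
    *-inverseʳ        : ∀ x (x≉0 : ¬ (x ≈ 0#)) → (x * inv x x≉0) ≈ 1#

-- The neutral elements and the opposite are determined by (S, +, *), so they
-- are quantified rather than prescribed.
FormsField : (S : Setoid 0ℓ 0ℓ) → let open Setoid S in (_+_ _*_ : Op₂ Carrier) → Set
FormsField S _+_ _*_ =
  ∃[ neg ] ∃[ 0# ] ∃[ 1# ] IsField (Setoid._≈_ S) _+_ _*_ neg 0# 1#

record FiniteField (m : ℕ) : Set₁ where
  infix  8 -_
  infixl 7 _*_
  infixl 6 _+_
  infix  4 _≈_
  field
    Carrier : Set
    _≈_     : Rel Carrier 0ℓ
    _+_ _*_ : Op₂ Carrier
    -_      : Op₁ Carrier
    0# 1#   : Carrier
    isField : IsField _≈_ _+_ _*_ -_ 0# 1#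

  open IsField isField public using (isCommutativeRing; 0≉1; inv; *-inverseʳ)

  commutativeRing : CommutativeRing 0ℓ 0ℓ
  commutativeRing = record { isCommutativeRing = isCommutativeRing }

  open CommutativeRing commutativeRing public
    hiding (Carrier; _≈_; _+_; _*_; -_; 0#; 1#; isCommutativeRing; zero)

  field
    order : HasOrder setoid m

  NonZeroElement : Set
  NonZeroElement = Σ[ x ∈ Carrier ] ¬ (x ≈ 0#)

  infixl 7 _/_
  _/_ : Carrier → NonZeroElement → Carrier
  x / (y , y≉0) = x * inv y y≉0

record Subfield {m : ℕ} (K : FiniteField m) (d : ℕ) : Set₁ where
  open FiniteField K
  field
    Member   : Pred Carrier 0ℓ
    resp     : ∀ {x y} → x ≈ y → x ∈ Member → y ∈ Member
    0∈       : 0# ∈ Member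
    1∈       : 1# ∈ Member
    +-closed : ∀ {x y} → x ∈ Member → y ∈ Member → x + y ∈ Member
    -‿closed : ∀ {x} → x ∈ Member → - x ∈ Member
    *-closed : ∀ {x y} → x ∈ Member → y ∈ Member → x * y ∈ Member
    inv-closed : ∀ {x} (x≉0 : ¬ (x ≈ 0#)) → x ∈ Member → inv x x≉0 ∈ Member
    order    : HasOrder (subsetSetoid setoid Member) d

private
  absorb : ∀ n k → suc k ℕ.* (suc n C suc k) ≡ suc n ℕ.* (n C k)
  absorb n zero = ≡.trans (≡.cong (1 ℕ.*_) (nC1≡n (suc n)))
                          (≡.trans (ℕ.*-identityˡ (suc n)) (≡.sym (ℕ.*-identityʳ (suc n))))
  absorb zero (suc k) = ≡.trans (ℕ.*-zeroʳ (suc (suc k))) ≡.refl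
  absorb (suc n) (suc k) = begin
    suc (suc k) ℕ.* (suc (suc n) C suc (suc k))
      ≡⟨ ≡.cong (suc (suc k) ℕ.*_) (nCk+nC[k+1]≡[n+1]C[k+1] (suc n) (suc k)) ⟨
    suc (suc k) ℕ.* (a ℕ.+ b)
      ≡⟨ ℕ.*-distribˡ-+ (suc (suc k)) a b ⟩
    (a ℕ.+ suc k ℕ.* a) ℕ.+ suc (suc k) ℕ.* b
      ≡⟨ ≡.cong₂ (λ u v → (a ℕ.+ u) ℕ.+ v) (absorb n k) (absorb n (suc k)) ⟩
    (a ℕ.+ suc n ℕ.* c) ℕ.+ suc n ℕ.* d
      ≡⟨ ℕ.+-assoc a _ _ ⟩
    a ℕ.+ (suc n ℕ.* c ℕ.+ suc n ℕ.* d)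
      ≡⟨ ≡.cong (a ℕ.+_) (ℕ.*-distribˡ-+ (suc n) c d) ⟨
    a ℕ.+ suc n ℕ.* (c ℕ.+ d)
      ≡⟨ ≡.cong (λ u → a ℕ.+ suc n ℕ.* u) (nCk+nC[k+1]≡[n+1]C[k+1] n k) ⟩
    a ℕ.+ suc n ℕ.* a ∎
    where
    open ≡.≡-Reasoning
    a = suc n C suc k
    b = suc n C suc (suc k)
    c = n C k
    d = n C suc k

  p∣pC : ∀ p' → Prime (suc p') → ∀ k → k < p' → suc p' ∣ (suc p' C suc k)
  p∣pC p' pr k k<p'
    with euclidsLemma (suc k) (suc p' C suc k) pr
           (divides (p' C k) (≡.trans (absorb p' k) (ℕ.*-comm (suc p') (p' C k))))
  ... | inj₁ p∣k = ⊥-elim (>⇒∤ (s≤s k<p') p∣k)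
  ... | inj₂ p∣C = p∣C

-- x ↦ x ^ (q ^ i) is additive on a field with q ^ n elements; this is what
-- makes 𝕊 f closed under addition.
module Frobenius (q n : ℕ) (q-pp : IsPrimePower q) (K : FiniteField (q ℕ.^ n)) where
  open FiniteField K
  open Exp semiring
  open Mult semiring using (×-homo-1; ×-assoc-*; ×-congʳ; ×-congˡ; ×-assocˡ; ×1-homo-*) renaming (_×_ to _·_)
  open Sum semiring
  open SetoidReasoning setoid
  open AbelianGroupProperties +-abelianGroup using () renaming (∙-cancelˡ to +-cancelˡ)

  private
    p k : ℕ
    p = proj₁ q-pp
    k = proj₁ (proj₂ q-pp)

    p-prime : Prime p
    p-prime = proj₁ (proj₂ (proj₂ q-pp))

    q≡p^k : q ≡ p ℕ.^ k
    q≡p^k = proj₂ (proj₂ (proj₂ (proj₂ q-pp)))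

    N : ℕ
    N = q ℕ.^ n

    module E = Inverse order

    elem : Fin N → Carrier
    elem = E.from

    elem-index : ∀ x → elem (E.to x) ≈ x
    elem-index x = E.inverseʳ ≡.refl

    _≈?_ : ∀ x y → Dec (x ≈ y)
    x ≈? y = map′ (λ e → trans (sym (elem-index x)) (trans (E.from-cong e) (elem-index y)))
                  E.to-cong (E.to x Fin.≟ E.to y)

    shift : Carrier → Fin N → Fin N
    shift c i = E.to (elem i + c)

    shift-shift : ∀ c d → c + d ≈ 0# → ∀ i → shift d (shift c i) ≡ i
    shift-shift c d c+d≈0 i = E.inverseˡ (begin
      elem (shift c i) + d ≈⟨ +-congʳ (elem-index _) ⟩
      elem i + c + d       ≈⟨ +-assoc _ _ _ ⟩
      elem i + (c + d)     ≈⟨ +-congˡ c+d≈0 ⟩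
      elem i + 0#          ≈⟨ +-identityʳ _ ⟩
      elem i               ∎)

    shiftPerm : Permutation′ N
    shiftPerm = permutation (shift 1#) (shift (- 1#))
      (shift-shift (- 1#) 1# (-‿inverseˡ 1#)) (shift-shift 1# (- 1#) (-‿inverseʳ 1#))

    N·1≈0 : N · 1# ≈ 0#
    N·1≈0 = +-cancelˡ (sum elem) (N · 1#) 0# (begin
      sum elem + N · 1#            ≈⟨ +-congˡ (sum-replicate N) ⟨
      sum elem + sum {N} (λ _ → 1#) ≈⟨ ∑-distrib-+ elem (λ _ → 1#) ⟨
      sum (λ i → elem i + 1#)      ≈⟨ sum-cong-≋ (λ i → elem-index (elem i + 1#)) ⟨
      sum (elem ∘ shift 1#)        ≈⟨ sum-permute elem shiftPerm ⟨
      sum elem                     ≈⟨ +-identityʳ _ ⟨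
      sum elem + 0#                ∎)

    p^j·1≈0⇒p·1≈0 : ∀ j → (p ℕ.^ j) · 1# ≈ 0# → p · 1# ≈ 0#
    p^j·1≈0⇒p·1≈0 zero    h = ⊥-elim (0≉1 (sym (trans (sym (×-homo-1 1#)) h)))
    p^j·1≈0⇒p·1≈0 (suc j) h with (p · 1#) ≈? 0#
    ... | yes e = e
    ... | no p1≉0 = p^j·1≈0⇒p·1≈0 j (begin
      r                 ≈⟨ *-identityˡ r ⟨
      1# * r            ≈⟨ *-congʳ (*-inverseʳ (p · 1#) p1≉0) ⟨
      (p · 1#) * i * r  ≈⟨ *-congʳ (*-comm _ _) ⟩
      i * (p · 1#) * r  ≈⟨ *-assoc _ _ _ ⟩
      i * ((p · 1#) * r) ≈⟨ *-congˡ (×1-homo-* p (p ℕ.^ j)) ⟨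
      i * ((p ℕ.^ suc j) · 1#) ≈⟨ *-congˡ h ⟩
      i * 0#            ≈⟨ zeroʳ i ⟩
      0#                ∎)
      where
      r = (p ℕ.^ j) · 1#
      i = inv (p · 1#) p1≉0

  p·1≈0 : p · 1# ≈ 0#
  p·1≈0 = p^j·1≈0⇒p·1≈0 (k ℕ.* n)
    (trans (×-congˡ (≡.trans (≡.sym (ℕ.^-*-assoc p k n)) (≡.cong (ℕ._^ n) (≡.sym q≡p^k)))) N·1≈0)

  private
    p·x≈0 : ∀ x → p · x ≈ 0#
    p·x≈0 x = begin
      p · x         ≈⟨ ×-congʳ p (*-identityˡ x) ⟨
      p · (1# * x)  ≈⟨ ×-assoc-* p 1# x ⟨
      (p · 1#) * x  ≈⟨ *-congʳ p·1≈0 ⟩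
      0# * x        ≈⟨ zeroˡ x ⟩
      0#            ∎

    m·x≈0 : ∀ {m} → p ∣ m → ∀ x → m · x ≈ 0#
    m·x≈0 (divides c ≡.refl) x = begin
      (c ℕ.* p) · x ≈⟨ ×-congˡ (ℕ.*-comm c p) ⟩
      (p ℕ.* c) · x ≈⟨ ×-assocˡ x p c ⟨
      p · (c · x)   ≈⟨ p·x≈0 (c · x) ⟩
      0#            ∎

    module B = Binomial commutativeSemiring

    ^p-+ : ∀ p' → p ≡ suc p' → ∀ x y → (x + y) ^ suc p' ≈ x ^ suc p' + y ^ suc p'
    ^p-+ p' e x y = begin
      (x + y) ^ P                                ≈⟨ B.theorem P x y ⟩
      term zero + sum (term ∘ suc)               ≈⟨ +-congˡ (sum-init-last (term ∘ suc)) ⟩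
      term zero + (sum mid + term (fromℕ P))
        ≈⟨ +-cong first (+-cong (trans (sum-cong-≋ mid≈0) (sum-replicate-zero p')) final) ⟩
      y ^ P + (0# + x ^ P)                       ≈⟨ +-congˡ (+-identityˡ _) ⟩
      y ^ P + x ^ P                              ≈⟨ +-comm _ _ ⟩
      x ^ P + y ^ P                              ∎
      where
      P = suc p'
      term : Fin (suc P) → Carrier
      term = B.binomialTerm x y P
      mid : Fin p' → Carrier
      mid i = term (suc (inject₁ i))
      mid≈0 : ∀ i → mid i ≈ 0#
      mid≈0 i = m·x≈0 (≡.subst (_∣ (P C suc (toℕ (inject₁ i)))) (≡.sym e)
                  (p∣pC p' (≡.subst Prime e p-prime) (toℕ (inject₁ i))
                    (≡.subst (_< p') (≡.sym (Fin.toℕ-inject₁ i)) (Fin.toℕ<n i)))) _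
      first : term zero ≈ y ^ P
      first = trans (×-homo-1 _) (*-identityˡ _)
      final : term (fromℕ P) ≈ x ^ P
      final = begin
        (P C toℕ (fromℕ P)) · (x ^ toℕ (fromℕ P) * y ^ (P ℕ.∸ toℕ (fromℕ P)))
          ≡⟨ ≡.cong (λ j → (P C j) · (x ^ j * y ^ (P ℕ.∸ j))) (Fin.toℕ-fromℕ P) ⟩
        (P C P) · (x ^ P * y ^ (P ℕ.∸ P))
          ≡⟨ ≡.cong₂ (λ c d → c · (x ^ P * y ^ d)) (nCn≡1 P) (ℕ.n∸n≡0 P) ⟩
        1 · (x ^ P * 1#)  ≈⟨ ×-homo-1 _ ⟩
        x ^ P * 1#        ≈⟨ *-identityʳ _ ⟩
        x ^ P             ∎

    ^p-additive : ∀ x y → (x + y) ^ p ≈ x ^ p + y ^ p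
    ^p-additive x y with p in e | prime⇒nonTrivial p-prime
    ... | suc p' | _ = ^p-+ p' e x y

    ^p^j-additive : ∀ j x y → (x + y) ^ (p ℕ.^ j) ≈ x ^ (p ℕ.^ j) + y ^ (p ℕ.^ j)
    ^p^j-additive zero x y =
      trans (*-identityʳ _) (sym (+-cong (*-identityʳ x) (*-identityʳ y)))
    ^p^j-additive (suc j) x y = begin
      (x + y) ^ (p ℕ.* p ℕ.^ j)                 ≈⟨ ^-assocʳ (x + y) p (p ℕ.^ j) ⟨
      ((x + y) ^ p) ^ (p ℕ.^ j)                 ≈⟨ ^-congˡ (p ℕ.^ j) (^p-additive x y) ⟩
      (x ^ p + y ^ p) ^ (p ℕ.^ j)               ≈⟨ ^p^j-additive j (x ^ p) (y ^ p) ⟩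
      (x ^ p) ^ (p ℕ.^ j) + (y ^ p) ^ (p ℕ.^ j) ≈⟨ +-cong (^-assocʳ x p (p ℕ.^ j)) (^-assocʳ y p (p ℕ.^ j)) ⟩
      x ^ (p ℕ.* p ℕ.^ j) + y ^ (p ℕ.* p ℕ.^ j) ∎

  ^q^i-additive : ∀ i x y → (x + y) ^ (q ℕ.^ i) ≈ x ^ (q ℕ.^ i) + y ^ (q ℕ.^ i)
  ^q^i-additive i x y =
    ≡.subst (λ m → (x + y) ^ m ≈ x ^ m + y ^ m)
      (≡.trans (≡.sym (ℕ.^-*-assoc p k i)) (≡.cong (ℕ._^ i) (≡.sym q≡p^k)))
      (^p^j-additive (k ℕ.* i) x y)

module _ (q n : ℕ) (K : FiniteField (q ℕ.^ n)) where
  open FiniteField K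
  open Exp semiring
  open Sum semiring

  -- The coefficients (a₀ , … , aₙ₋₁) of ∑ aᵢ x^(q^i).
  QPolynomial : Set
  QPolynomial = Vector Carrier n

  eval : QPolynomial → Carrier → Carrier
  eval a x = ∑[ i < n ] (a i * x ^ (q ℕ.^ toℕ i))

  -- A finite field has at most one subfield of a given order, so the two
  -- arguments carry no choice: they are 𝔽_q and 𝔽_{q^t} inside K = 𝔽_{q^n}.
  RPartiallyScattered : ∀ {t} → Subfield K q → Subfield K (q ℕ.^ t) → QPolynomial → Set
  RPartiallyScattered 𝔽q 𝔽qᵗ f =
    (y z : NonZeroElement) →
    eval f (proj₁ y) / y ≈ eval f (proj₁ z) / z →
    proj₁ y / z ∈ Subfield.Member 𝔽qᵗ →
    proj₁ y / z ∈ Subfield.Member 𝔽q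

  Vec₂ Mat₂ : Set
  Vec₂ = Vector Carrier 2
  Mat₂ = Fin 2 → Fin 2 → Carrier

  infix 4 _≈ᵥ_ _≈ₘ_
  _≈ᵥ_ : Rel Vec₂ 0ℓ
  v ≈ᵥ w = ∀ i → v i ≈ w i

  _≈ₘ_ : Rel Mat₂ 0ℓ
  A ≈ₘ B = ∀ i j → A i j ≈ B i j

  matSetoid : Setoid 0ℓ 0ℓ
  matSetoid = record
    { Carrier = Mat₂
    ; _≈_ = _≈ₘ_
    ; isEquivalence = record
        { refl  = λ _ _ → refl
        ; sym   = λ e i j → sym (e i j)
        ; trans = λ e e′ i j → trans (e i j) (e′ i j)
        }
    }

  infixl 6 _+ₘ_
  infixl 7 _*ₘ_ _*ᵥ_
  _+ₘ_ _*ₘ_ : Op₂ Mat₂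
  (A +ₘ B) i j = A i j + B i j
  (A *ₘ B) i j = ∑[ k < 2 ] (A i k * B k j)

  _*ᵥ_ : Mat₂ → Vec₂ → Vec₂
  (A *ᵥ v) i = ∑[ k < 2 ] (A i k * v k)

  graphPoint : QPolynomial → Carrier → Vec₂
  graphPoint f y zero    = y
  graphPoint f y (suc _) = eval f y

  Graph : QPolynomial → Pred Vec₂ 0ℓ
  Graph f v = ∃[ y ] v ≈ᵥ graphPoint f y

  Image : Mat₂ → QPolynomial → Pred Vec₂ 0ℓ
  Image A f v = ∃[ y ] v ≈ᵥ A *ᵥ graphPoint f y

  𝕊 : QPolynomial → Pred Mat₂ 0ℓ
  𝕊 f A = Image A f ⊆ Graph f

  𝕊-setoid : QPolynomial → Setoid 0ℓ 0ℓ
  𝕊-setoid f = subsetSetoid matSetoid (𝕊 f)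

  private
    *ᵥ-cong : ∀ A {v w} → v ≈ᵥ w → A *ᵥ v ≈ᵥ A *ᵥ w
    *ᵥ-cong A e i = sum-cong-≋ {2} (λ k → *-congˡ {A i k} (e k))

    *ᵥ-assoc : ∀ A B v → (A *ₘ B) *ᵥ v ≈ᵥ A *ᵥ (B *ᵥ v)
    *ᵥ-assoc A B v i = begin
      ∑[ j < 2 ] ((∑[ k < 2 ] (A i k * B k j)) * v j)
        ≈⟨ sum-cong-≋ {2} (λ j → *-distribʳ-sum {2} (v j) (λ k → A i k * B k j)) ⟩
      ∑[ j < 2 ] ∑[ k < 2 ] (A i k * B k j * v j)
        ≈⟨ ∑-comm {2} {2} (λ j k → A i k * B k j * v j) ⟩
      ∑[ k < 2 ] ∑[ j < 2 ] (A i k * B k j * v j)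
        ≈⟨ sum-cong-≋ {2} (λ k → sum-cong-≋ {2} (λ j → *-assoc (A i k) (B k j) (v j))) ⟩
      ∑[ k < 2 ] ∑[ j < 2 ] (A i k * (B k j * v j))
        ≈⟨ sum-cong-≋ {2} (λ k → *-distribˡ-sum {2} (A i k) (λ j → B k j * v j)) ⟨
      ∑[ k < 2 ] (A i k * (∑[ j < 2 ] (B k j * v j))) ∎
      where open SetoidReasoning setoid

    *ᵥ-distrib : ∀ A B v i → ((A +ₘ B) *ᵥ v) i ≈ (A *ᵥ v) i + (B *ᵥ v) i
    *ᵥ-distrib A B v i = trans
      (sum-cong-≋ {2} (λ k → distribʳ (v k) (A i k) (B i k)))
      (∑-distrib-+ {2} (λ k → A i k * v k) (λ k → B i k * v k))

  𝕊-*-closed : ∀ f A B → A ∈ 𝕊 f → B ∈ 𝕊 f → A *ₘ B ∈ 𝕊 f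
  𝕊-*-closed f A B A∈ B∈ (y , e) with B∈ (y , λ _ → refl)
  ... | z , e′ = A∈ (z , λ i → trans (e i) (trans (*ᵥ-assoc A B (graphPoint f y) i) (*ᵥ-cong A e′ i)))

  module _ (q-pp : IsPrimePower q) where

    eval-+ : ∀ f x y → eval f (x + y) ≈ eval f x + eval f y
    eval-+ f x y = trans
      (sum-cong-≋ {n} (λ i → trans
        (*-congˡ (Frobenius.^q^i-additive q n q-pp K (toℕ i) x y))
        (distribˡ (f i) _ _)))
      (∑-distrib-+ {n} (λ i → f i * x ^ (q ℕ.^ toℕ i)) (λ i → f i * y ^ (q ℕ.^ toℕ i)))

    𝕊-+-closed : ∀ f A B → A ∈ 𝕊 f → B ∈ 𝕊 f → A +ₘ B ∈ 𝕊 f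
    𝕊-+-closed f A B A∈ B∈ (y , e) with A∈ (y , λ _ → refl) | B∈ (y , λ _ → refl)
    ... | u , eᵤ | w , e_w = u + w , on-graph
      where
      split : ∀ i → ((A +ₘ B) *ᵥ graphPoint f y) i ≈ graphPoint f u i + graphPoint f w i
      split i = trans (*ᵥ-distrib A B (graphPoint f y) i) (+-cong (eᵤ i) (e_w i))
      on-graph : _ ≈ᵥ graphPoint f (u + w)
      on-graph zero       = trans (e zero) (split zero)
      on-graph (suc zero) = trans (e (suc zero)) (trans (split (suc zero)) (sym (eval-+ f u w)))

    𝕊-+ 𝕊-* : (f : QPolynomial) → Op₂ (Setoid.Carrier (𝕊-setoid f))
    𝕊-+ f (A , A∈) (B , B∈) = A +ₘ B , 𝕊-+-closed f A B A∈ B∈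
    𝕊-* f (A , A∈) (B , B∈) = A *ₘ B , 𝕊-*-closed f A B A∈ B∈

    𝕊-FormsField : QPolynomial → Set
    𝕊-FormsField f = FormsField (𝕊-setoid f) (𝕊-+ f) (𝕊-* f)

{-# OPTIONS --safe #-}
-- The example is f = x⁴ + x⁸ over 𝔽₁₆, with q = 2, n = 4, t = 2.  If λ ∈ 𝔽₄*, then
-- f(λz) / (λz) = z³ + λz⁷, which equals f(z) / z only for λ = 1; so f is
-- R-4-partially scattered.  For a primitive cube root of unity ω, the matrix with rows
-- (ω , 1) and (1 , ω²) maps the graph of f into itself.  It has determinant 0 and trace 1,
-- so it is an idempotent of 𝕊 f other than 0 and 1, which no field contains.
module Submission where

open import Defs
open import Algebra.Bundles using (AbelianGroup; CommutativeRing)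
import Algebra.Construct.DirectProduct as DirectProduct
import Algebra.Properties.Semiring.Exp as Exp
import Algebra.Solver.Ring.NaturalCoefficients.Default as RingSolver
open import Algebra.Structures using (IsCommutativeRing)
open import Data.Bool.Base using (Bool; true; false)
import Data.Bool.Properties as Bool
open import Data.Fin.Base using (zero; suc)
import Data.Fin.Properties as Fin
open import Data.Nat as ℕ using (ℕ; _<_; _^_; z≤n; s≤s)
open import Data.Nat.Divisibility using (_∣_; divides)
open import Data.Nat.Primality using (prime[2])
open import Data.Product using (Σ-syntax; ∃-syntax; _×_; _,_; proj₁; proj₂; curry; uncurry)
open import Data.Product.Function.NonDependent.Setoid using (_×-inverse_)
open import Data.Product.Relation.Binary.Pointwise.NonDependent using (×-setoid; ×-decidable; Pointwise-≡↔≡)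
open import Function.Construct.Composition using (inverse)
open import Function.Construct.Symmetry using () renaming (inverse to sym-inverse)
open import Level using (0ℓ)
open import Relation.Binary.Bundles using (Setoid)
open import Relation.Binary.Definitions using () renaming (Decidable to Decidable₂)
open import Relation.Binary.PropositionalEquality as ≡ using (_≡_)
import Relation.Binary.Reasoning.Setoid as SetoidReasoning
open import Relation.Nullary using (¬_; Dec)
open import Relation.Nullary.Decidable using (map′; ¬?; _×-dec_; _→-dec_; from-yes)
open import Relation.Unary using (Pred; Decidable; _∈_)

-- Idempotents in a field, and membership in `𝕊`.

module _ {a ℓ} {A : Set a} {_≈_ : A → A → Set ℓ} {_+_ _*_ : A → A → A}
         {neg : A → A} {0# 1# : A}
         (isField : IsField _≈_ _+_ _*_ neg 0# 1#) where
  open IsField isField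
  private
    R : CommutativeRing a ℓ
    R = record { isCommutativeRing = isCommutativeRing }
  open CommutativeRing R using (setoid; *-congʳ; *-congˡ; *-assoc; *-identityʳ)
  open SetoidReasoning setoid

  -- Multiply `x * x ≈ x` by the inverse of `x`.
  idempotent⇒≈1 : ∀ x → ¬ (x ≈ 0#) → (x * x) ≈ x → x ≈ 1#
  idempotent⇒≈1 x x≉0 xx≈x = begin
    x                   ≈⟨ *-identityʳ x ⟨
    x * 1#              ≈⟨ *-congˡ (*-inverseʳ x x≉0) ⟨
    x * (x * inv x x≉0) ≈⟨ *-assoc x x _ ⟨
    (x * x) * inv x x≉0 ≈⟨ *-congʳ xx≈x ⟩
    x * inv x x≉0       ≈⟨ *-inverseʳ x x≉0 ⟩
    1#                  ∎

module _ (q n : ℕ) (K : FiniteField (q ^ n)) (f : QPolynomial q n K) where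
  open FiniteField K

  -- A point of the graph is determined by its first coordinate, so membership in `𝕊` reduces to one
  -- equation in `y`, which can be tested for each `y`.
  preserves-graph : ∀ A → (∀ y → let v = _*ᵥ_ q n K A (graphPoint q n K f y) in
                                 v (suc zero) ≈ eval q n K f (v zero)) → A ∈ 𝕊 q n K f
  preserves-graph A h (y , e) =
    _*ᵥ_ q n K A (graphPoint q n K f y) zero ,
    λ { zero → e zero ; (suc zero) → trans (e (suc zero)) (h y) }

-- Decision by exhaustion, and the order of a product.

Exhaustible : Set → Set₁
Exhaustible A = ∀ {P : Pred A 0ℓ} → Decidable P → Dec (∀ x → P x)

all-Bool? : Exhaustible Bool
all-Bool? P? = map′ (λ { (pf , pt) false → pf ; (pf , pt) true → pt })
                    (λ p → p false , p true) (P? false ×-dec P? true)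

all-×? : ∀ {A B} → Exhaustible A → Exhaustible B → Exhaustible (A × B)
all-×? allA? allB? P? =
  map′ uncurry curry (allA? λ a → allB? λ b → P? (a , b))

×-order : ∀ {S T : Setoid 0ℓ 0ℓ} {m n} → HasOrder S m → HasOrder T n →
          HasOrder (×-setoid S T) (m ℕ.* n)
×-order {m = m} {n} S≅m T≅n =
  inverse (S≅m ×-inverse T≅n)
    (inverse Pointwise-≡↔≡ (sym-inverse (Fin.*↔× {m} {n})))

-- Quadratic extensions and the tower 𝔽₂, 𝔽₄, 𝔽₁₆.

module QuadraticExtension (R : CommutativeRing 0ℓ 0ℓ) (s : CommutativeRing.Carrier R) where
  open CommutativeRing R
  open RingSolver commutativeSemiring using (solve; _:+_; _:*_; _:=_; con)

  -- (a , b) stands for a + b u, where u² = u + s.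
  _⊛_ : Carrier × Carrier → Carrier × Carrier → Carrier × Carrier
  (a , b) ⊛ (c , d) = a * c + s * (b * d) , a * d + b * c + b * d

  private
    module A = AbelianGroup (DirectProduct.abelianGroup +-abelianGroup +-abelianGroup)

    -- The relation `u² = u + s` involves no subtraction, so the laws of `_⊛_` are commutative
    -- semiring identities in the coordinates.
    ⊛-comm : ∀ x y → (x ⊛ y) A.≈ (y ⊛ x)
    ⊛-comm (a , b) (c , d) =
      solve 5 (λ s a b c d → a :* c :+ s :* (b :* d) := c :* a :+ s :* (d :* b)) refl s a b c d ,
      solve 4 (λ a b c d → a :* d :+ b :* c :+ b :* d := c :* b :+ d :* a :+ d :* b) refl a b c d

    ⊛-cong : ∀ {x x′ y y′} → x A.≈ x′ → y A.≈ y′ → (x ⊛ y) A.≈ (x′ ⊛ y′)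
    ⊛-cong (a , b) (c , d) =
      +-cong (*-cong a c) (*-congˡ (*-cong b d)) ,
      +-cong (+-cong (*-cong a d) (*-cong b c)) (*-cong b d)

    ⊛-assoc : ∀ x y z → ((x ⊛ y) ⊛ z) A.≈ (x ⊛ (y ⊛ z))
    ⊛-assoc (a , b) (c , d) (e , f) =
      solve 7 (λ s a b c d e f →
          (a :* c :+ s :* (b :* d)) :* e :+ s :* ((a :* d :+ b :* c :+ b :* d) :* f)
            := a :* (c :* e :+ s :* (d :* f)) :+ s :* (b :* (c :* f :+ d :* e :+ d :* f)))
        refl s a b c d e f ,
      solve 7 (λ s a b c d e f →
          (a :* c :+ s :* (b :* d)) :* f :+ (a :* d :+ b :* c :+ b :* d) :* e
              :+ (a :* d :+ b :* c :+ b :* d) :* f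
            := a :* (c :* f :+ d :* e :+ d :* f) :+ b :* (c :* e :+ s :* (d :* f))
              :+ b :* (c :* f :+ d :* e :+ d :* f))
        refl s a b c d e f

    ⊛-identityˡ : ∀ x → ((1# , 0#) ⊛ x) A.≈ x
    ⊛-identityˡ (a , b) =
      solve 3 (λ s a b → con 1 :* a :+ s :* (con 0 :* b) := a) refl s a b ,
      solve 2 (λ a b → con 1 :* b :+ con 0 :* a :+ con 0 :* b := b) refl a b

    ⊛-distribˡ : ∀ x y z → (x ⊛ (y A.∙ z)) A.≈ ((x ⊛ y) A.∙ (x ⊛ z))
    ⊛-distribˡ (a , b) (c , d) (e , f) =
      solve 7 (λ s a b c d e f →
          a :* (c :+ e) :+ s :* (b :* (d :+ f))
            := a :* c :+ s :* (b :* d) :+ (a :* e :+ s :* (b :* f)))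
        refl s a b c d e f ,
      solve 6 (λ a b c d e f →
          a :* (d :+ f) :+ b :* (c :+ e) :+ b :* (d :+ f)
            := a :* d :+ b :* c :+ b :* d :+ (a :* f :+ b :* e :+ b :* f))
        refl a b c d e f

  extension : CommutativeRing 0ℓ 0ℓ
  extension = record
    { _*_ = _⊛_
    ; 1#  = 1# , 0#
    ; isCommutativeRing = record
      { isRing = record
        { +-isAbelianGroup = A.isAbelianGroup
        ; *-cong     = ⊛-cong
        ; *-assoc    = ⊛-assoc
        ; *-identity = ⊛-identityˡ
                     , λ x → A.trans (⊛-comm x (1# , 0#)) (⊛-identityˡ x)
        ; distrib    = ⊛-distribˡ
                     , λ x y z → A.trans (⊛-comm (y A.∙ z) x)
                         (A.trans (⊛-distribˡ x y z) (A.∙-cong (⊛-comm x y) (⊛-comm x z)))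
        }
      ; *-comm = ⊛-comm
      }
    }

open QuadraticExtension using (extension)

-- On 𝔽₂ the map `x² + x` takes only the value 0, and on 𝔽₄ only 0 and 1. So `u² = u + 1` has no
-- root in 𝔽₂, and `u² = u + ω` has none in 𝔽₄, where `ω` is the generator `(false , true)`.
𝔽₂ 𝔽₄ 𝔽₁₆ : CommutativeRing 0ℓ 0ℓ
𝔽₂  = Bool.xor-∧-commutativeRing
𝔽₄  = extension 𝔽₂ true
𝔽₁₆ = extension 𝔽₄ (false , true)

𝔽₂-order : HasOrder (CommutativeRing.setoid 𝔽₂) 2
𝔽₂-order = sym-inverse Fin.2↔Bool

𝔽₄-order : HasOrder (CommutativeRing.setoid 𝔽₄) 4
𝔽₄-order = ×-order 𝔽₂-order 𝔽₂-order

-- The field of order 16 and its subfields of orders 2 and 4.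

open CommutativeRing 𝔽₁₆ hiding (zero)
open Exp semiring using () renaming (_^_ to _^ₖ_)

infix 4 _≈?_
_≈?_ : Decidable₂ _≈_
_≈?_ = ×-decidable (×-decidable Bool._≟_ Bool._≟_) (×-decidable Bool._≟_ Bool._≟_)

all? : Exhaustible Carrier
all? = all-×? (all-×? all-Bool? all-Bool?) (all-×? all-Bool? all-Bool?)

K : FiniteField 16
K = record
  { isField = record
    { isCommutativeRing = isCommutativeRing
    ; 0≉1        = λ ()
    -- The nonzero elements form a group of order 15. The power is defined at 0 as well, so inverses
    -- can be evaluated without a proof that `x` is nonzero.
    ; inv        = λ x _ → x ^ₖ 14
    ; *-inverseʳ = from-yes (all? λ x → ¬? (x ≈? 0#) →-dec (x * x ^ₖ 14 ≈? 1#))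
    }
  ; order = ×-order 𝔽₄-order 𝔽₄-order
  }

-- The closure axioms of a subfield gathered into one decidable proposition, with the 14th power in
-- place of the inverse.
Closed : Pred Carrier 0ℓ → Set
Closed P =
  (∀ x y → x ≈ y → P x → P y) × P 0# × P 1# × (∀ x y → P x → P y → P (x + y)) ×
  (∀ x → P x → P (- x)) × (∀ x y → P x → P y → P (x * y)) × (∀ x → P x → P (x ^ₖ 14))

closed? : ∀ {P} → Decidable P → Dec (Closed P)
closed? P? =
  (all? λ x → all? λ y → x ≈? y →-dec P? x →-dec P? y) ×-dec P? 0# ×-dec P? 1# ×-dec
  (all? λ x → all? λ y → P? x →-dec P? y →-dec P? (x + y)) ×-dec
  (all? λ x → P? x →-dec P? (- x)) ×-dec
  (all? λ x → all? λ y → P? x →-dec P? y →-dec P? (x * y)) ×-dec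
  (all? λ x → P? x →-dec P? (x ^ₖ 14))

subfield : ∀ {P} → Closed P → ∀ {d} → HasOrder (subsetSetoid setoid P) d → Subfield K d
subfield {P} (resp , 0∈ , 1∈ , +∈ , -∈ , *∈ , ^14∈) order = record
  { Member     = P
  ; resp       = resp _ _
  ; 0∈         = 0∈
  ; 1∈         = 1∈
  ; +-closed   = +∈ _ _
  ; -‿closed   = -∈ _
  ; *-closed   = *∈ _ _
  ; inv-closed = λ _ → ^14∈ _
  ; order      = order
  }

-- Each step of the tower embeds the smaller field as the pairs with second coordinate 0.
In𝔽₂ In𝔽₄ : Pred Carrier 0ℓ
In𝔽₂ ((a , b) , c) = b ≡ false × CommutativeRing._≈_ 𝔽₄ c (false , false)
In𝔽₄ (a , b) = CommutativeRing._≈_ 𝔽₄ b (false , false)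

in𝔽₄? : Decidable In𝔽₄
in𝔽₄? (a , b) = ×-decidable Bool._≟_ Bool._≟_ b (false , false)

in𝔽₂? : Decidable In𝔽₂
in𝔽₂? ((a , b) , c) = (b Bool.≟ false) ×-dec ×-decidable Bool._≟_ Bool._≟_ c (false , false)

K₂ : Subfield K 2
K₂ = subfield (from-yes (closed? in𝔽₂?)) (inverse (record
  { to        = λ { (((a , _) , _) , _) → a }
  ; from      = λ a → ((a , false) , (false , false)) , ≡.refl , ≡.refl , ≡.refl
  ; to-cong   = λ ((e , _) , _) → e
  ; from-cong = λ e → (e , ≡.refl) , (≡.refl , ≡.refl)
  ; inverse   = (λ ((e , _) , _) → e)
              , λ { {_ , b≡0 , c≈0} e → (e , ≡.sym b≡0) , (≡.sym (proj₁ c≈0) , ≡.sym (proj₂ c≈0)) }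
  }) 𝔽₂-order)

K₄ : Subfield K 4
K₄ = subfield (from-yes (closed? in𝔽₄?)) (inverse {S = CommutativeRing.setoid 𝔽₄} (record
  { to        = λ ((a , _) , _) → a
  ; from      = λ a → (a , (false , false)) , ≡.refl , ≡.refl
  ; to-cong   = proj₁
  ; from-cong = λ e → e , (≡.refl , ≡.refl)
  ; inverse   = proj₁
              , λ { {_ , b≈0} e → e , (≡.sym (proj₁ b≈0) , ≡.sym (proj₂ b≈0)) }
  }) 𝔽₄-order)

-- The polynomial and its partial scatteredness.

2-primePower : IsPrimePower 2
2-primePower = 2 , 1 , prime[2] , s≤s z≤n , ≡.refl

x⁴+x⁸ : QPolynomial 2 4 K
x⁴+x⁸ zero                   = 0#
x⁴+x⁸ (suc zero)             = 0#
x⁴+x⁸ (suc (suc zero))       = 1#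
x⁴+x⁸ (suc (suc (suc zero))) = 1#

f : Carrier → Carrier
f = eval 2 4 K x⁴+x⁸

-- All pairs are tested. By hand, `λ⁴ = λ` and `λ⁸ = λ²` on 𝔽₄, so the quotients at `λz` and `z`
-- differ by `(λ - 1) z⁷`.
f-scattered : RPartiallyScattered 2 4 K {2} K₂ K₄ x⁴+x⁸
f-scattered (y , y≉0) (z , z≉0) =
  from-yes (all? λ y → all? λ z → ¬? (y ≈? 0#) →-dec ¬? (z ≈? 0#) →-dec
    f y * y ^ₖ 14 ≈? f z * z ^ₖ 14 →-dec
    in𝔽₄? (y * z ^ₖ 14) →-dec in𝔽₂? (y * z ^ₖ 14)) y z y≉0 z≉0

-- A nontrivial idempotent of `𝕊`.

ω : Carrier
ω = (false , true) , (false , false)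

E I : Mat₂ 2 4 K
E zero    zero    = ω
E zero    (suc _) = 1#
E (suc _) zero    = 1#
E (suc _) (suc _) = ω * ω
I zero    zero    = 1#
I zero    (suc _) = 0#
I (suc _) zero    = 0#
I (suc _) (suc _) = 1#

-- By hand, `y¹⁶ = y` gives `f (f y) = y + y⁴`, and `f (ω * y) = ω y⁴ + ω² y⁸`. Since `1 + ω = ω²`,
-- these add up to `y + ω² f(y)`, the second coordinate of the image of `(y , f y)`.
E∈𝕊 : E ∈ 𝕊 2 4 K x⁴+x⁸
E∈𝕊 = preserves-graph 2 4 K x⁴+x⁸ E (from-yes (all? λ y →
  let v = _*ᵥ_ 2 4 K E (graphPoint 2 4 K x⁴+x⁸ y) in v (suc zero) ≈? f (v zero)))

I∈𝕊 : I ∈ 𝕊 2 4 K x⁴+x⁸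
I∈𝕊 = preserves-graph 2 4 K x⁴+x⁸ I (from-yes (all? λ y →
  let v = _*ᵥ_ 2 4 K I (graphPoint 2 4 K x⁴+x⁸ y) in v (suc zero) ≈? f (v zero)))

-- This is Cayley-Hamilton with trace `ω + ω² = 1` and determinant `ω³ - 1 = 0`.
E-idempotent : _≈ₘ_ 2 4 K (_*ₘ_ 2 4 K E E) E
E-idempotent = from-yes (Fin.all? λ i → Fin.all? λ j → _*ₘ_ 2 4 K E E i j ≈? E i j)

-- The neutral elements of the supposed field are arbitrary members of `𝕊`, so each is excluded
-- through its defining law: `E ≈ 0𝕊` would give `E + E ≈ E`, and `E ≈ 1𝕊` would give `E * I ≈ I`.
𝕊-notField : ¬ 𝕊-FormsField 2 4 K 2-primePower x⁴+x⁸
𝕊-notField (_ , 0𝕊 , 1𝕊 , isField) = EI≉I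
  (F.trans {E𝕊 ⊗ I𝕊} {1𝕊 ⊗ I𝕊} {I𝕊}
    (F.*-congʳ {I𝕊} {E𝕊} {1𝕊} (idempotent⇒≈1 isField E𝕊 E≉0 E-idempotent)) (F.*-identityˡ I𝕊))
  where
  open Setoid (𝕊-setoid 2 4 K x⁴+x⁸) using () renaming (_≈_ to _≈𝕊_)
  module F = IsCommutativeRing (IsField.isCommutativeRing isField)
  _⊕_ = 𝕊-+ 2 4 K 2-primePower x⁴+x⁸
  _⊗_ = 𝕊-* 2 4 K 2-primePower x⁴+x⁸
  E𝕊 I𝕊 : Setoid.Carrier (𝕊-setoid 2 4 K x⁴+x⁸)
  E𝕊 = E , E∈𝕊
  I𝕊 = I , I∈𝕊
  EI≉I : ¬ ((E𝕊 ⊗ I𝕊) ≈𝕊 I𝕊)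
  -- The two entries are `ω` and 1.
  EI≉I e with e zero zero
  ... | (() , _) , _
  E+E≉E : ¬ ((E𝕊 ⊕ E𝕊) ≈𝕊 E𝕊)
  -- In characteristic 2 the entries are `1 + 1 = 0` and 1.
  E+E≉E e with e (suc zero) zero
  ... | (() , _) , _
  E≉0 : ¬ (E𝕊 ≈𝕊 0𝕊)
  E≉0 e = E+E≉E (F.trans {E𝕊 ⊕ E𝕊} {0𝕊 ⊕ E𝕊} {E𝕊}
    (F.+-congʳ {E𝕊} {E𝕊} {0𝕊} e) (F.+-identityˡ E𝕊))

corollary3p12 : ∃[ q ] ∃[ n ] ∃[ t ] Σ[ q-pp ∈ IsPrimePower q ]
    t ∣ n × 1 < t × t < n ×
    (Σ[ K ∈ FiniteField (q ^ n) ] Σ[ 𝔽q ∈ Subfield K q ] Σ[ 𝔽qᵗ ∈ Subfield K (q ^ t) ]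
    Σ[ f ∈ QPolynomial q n K ]
    RPartiallyScattered q n K {t} 𝔽q 𝔽qᵗ f × ¬ 𝕊-FormsField q n K q-pp f)
corollary3p12 =
  2 , 4 , 2 , 2-primePower , divides 2 ≡.refl , s≤s (s≤s z≤n) , s≤s (s≤s (s≤s z≤n)) ,
  K , K₂ , K₄ , x⁴+x⁸ , f-scattered , 𝕊-notField
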